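{- $R(4,8)\ge 58$. Equivalently, there exists a two-coloring of the edges of the complete graph $K_{57}$ such that there is no complete subgraph on 4 vertices all of whose edges have the first color, and no complete subgraph on 8 vertices all of whose edges have the second color.
   Context: For positive integers $s,t$, the classical Ramsey number $R(s,t)$ is the smallest integer $n$ such that every two-coloring of the edges of the complete graph $K_n$ contains a copy of $K_s$ all of whose edges have the first color or a copy of $K_t$ all of whose edges have the second color. -}

module Defs where

open import Data.Nat using (ℕ)
open import Data.Fin using (Fin)
open import Data.Bool using (Bool; true; false)
open import Data.Product using (Σ; _×_)
open import Relation.Binary.PropositionalEquality using (_≡_)
open import Relation.Nullary using (¬_)
open import Function.Definitions using (Injective)

-- A two-coloring of the edges of K_n: a symmetric function on pairs of
-- vertices (values on the diagonal are irrelevant). true = first color,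
-- false = second color.
record Coloring (n : ℕ) : Set where
  field
    colour : Fin n → Fin n → Bool
    symmetric : ∀ i j → colour i j ≡ colour j i
open Coloring public

MonoClique : ∀ {n} → Coloring n → Bool → ℕ → Set
MonoClique {n} c b s =
  Σ (Fin s → Fin n) λ f →
    Injective _≡_ _≡_ f ×
    (∀ i j → ¬ (i ≡ j) → colour c (f i) (f j) ≡ b)

RamseyLowerWitness : ℕ → ℕ → ℕ → Set
RamseyLowerWitness n s t =
  Σ (Coloring n) λ c → ¬ MonoClique c true s × ¬ MonoClique c false t

{-# OPTIONS --safe #-}
-- The coloring was found by simulated annealing among the colorings of K₅₇
-- that are invariant under S₃ acting on 19 triples of vertices.  Such a
-- coloring amounts to two symmetric 19 × 19 matrices: the color of the edge
-- joining vertex x of triple i to vertex y of triple j is the (i , j) entry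
-- of the first matrix if x = y, and of the second one otherwise.  That it has
-- no forbidden clique is established by exhaustive backtracking, which visits
-- about 145 000 partial cliques of the second color.
module Submission where

open import Defs

open import Data.Bool using (Bool; true; false; _∧_; if_then_else_)
import Data.Bool.Properties as Bool
open import Data.Fin using (Fin; zero; suc; toℕ; punchIn; remQuot)
open import Data.Fin.Properties using (all?; sequence; punchIn-injective; punchInᵢ≢i)
open import Data.List using (List; []; _∷_; filter; map; allFin)
open import Data.List.Membership.Propositional using (_∈_)
open import Data.List.Membership.Propositional.Properties using (∈-filter⁺; ∈-map⁺; ∈-allFin)
open import Data.List.Relation.Unary.Any using (here; there)
open import Data.Nat using (ℕ; zero; suc; _∸_; _^_; _/_; _%_; _≡ᵇ_; NonZero)
open import Data.Nat.Properties using (m^n≢0)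
open import Data.Product using (∃; _×_; _,_; proj₁; proj₂)
open import Data.Sum using (_⊎_; inj₁; inj₂; [_,_]′; map₁)
import Data.Sum.Effectful.Left as Sumₗ
open import Data.Vec using (Vec; []; _∷_; lookup)
open import Function using (_∘_; id)
open import Function.Definitions using (Injective)
open import Level using (0ℓ)
open import Relation.Binary.PropositionalEquality using (_≡_; _≢_; refl; sym; trans; cong; subst)
open import Relation.Nullary using (¬_; contradiction)
open import Relation.Nullary.Decidable using (from-yes)

-- Traversing `Fin n` in the applicative `∃ P ⊎_` stops at an index that yields a `P` and otherwise
-- collects every `Q`.
∃⊎∀ : ∀ {n} {P Q : Fin n → Set} → (∀ i → P i ⊎ Q i) → ∃ P ⊎ (∀ i → Q i)
∃⊎∀ {P = P} split = sequence (Sumₗ.applicative (∃ P) 0ℓ) λ i → map₁ (i ,_) (split i)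

∧-true : ∀ {x y} → x ∧ y ≡ true → x ≡ true × y ≡ true
∧-true {true} {true} _ = refl , refl

∈-uncons : ∀ {A : Set} {x y : A} {ys} → x ∈ y ∷ ys → x ≡ y ⊎ x ∈ ys
∈-uncons (here eq)  = inj₁ eq
∈-uncons (there x∈) = inj₂ x∈

module CliqueSearch {V : Set} (col : V → V → Bool) (b : Bool) where

  -- `false` at size `zero`, since the empty clique always exists.
  cliqueFree : ℕ → List V → Bool
  cliqueFree zero    _        = false
  cliqueFree (suc k) []       = true
  cliqueFree (suc k) (v ∷ vs) =
    cliqueFree k (filter (λ w → col v w Bool.≟ b) vs) ∧ cliqueFree (suc k) vs

  -- A clique either avoids the head `v` and lies in `vs`, or contains `v`, and then its other
  -- vertices survive the filter.
  cliqueFree-sound : ∀ k vs → cliqueFree k vs ≡ true →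
    (f : Fin k → V) → Injective _≡_ _≡_ f →
    (∀ i j → i ≢ j → col (f i) (f j) ≡ b) → ¬ (∀ i → f i ∈ vs)
  cliqueFree-sound (suc k) []       _    f _   _    f∈ with () ← f∈ zero
  cliqueFree-sound (suc k) (v ∷ vs) free f inj mono f∈ =
    [ through-v
    , cliqueFree-sound (suc k) vs (proj₂ (∧-true free)) f inj mono
    ]′ (∃⊎∀ (∈-uncons ∘ f∈))
    where
    through-v : ¬ ∃ λ i → f i ≡ v
    through-v (i , fi≡v) =
      -- `punchIn i` skips the index sent to `v`, leaving a clique of size `k`.
      cliqueFree-sound k _ (proj₁ (∧-true free)) (f ∘ punchIn i)
        (punchIn-injective i _ _ ∘ inj)
        (λ j l j≢l → mono _ _ (j≢l ∘ punchIn-injective i j l))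
        λ j → ∈-filter⁺ (λ w → col v w Bool.≟ b)
          -- By injectivity `v` is not among the remaining vertices.
          ([ (λ fj≡v → contradiction (inj (trans fj≡v (sym fi≡v))) (punchInᵢ≢i i j))
           , id
           ]′ (∈-uncons (f∈ (punchIn i j))))
          (subst (λ u → col u _ ≡ b) fi≡v (mono i _ (punchInᵢ≢i i j ∘ sym)))

-- Each row is a binary number whose leading digit is column 0.
sameRows crossRows : Vec ℕ 19
sameRows =
  0b0010000011110000000 ∷
  0b0010001011011101100 ∷
  0b1100010001110010010 ∷
  0b0000011100100111000 ∷
  0b0000011000001011010 ∷
  0b0011101111001000110 ∷
  0b0101110001110010101 ∷
  0b0001010000010010001 ∷
  0b1100010000100011100 ∷
  0b1110011000000011001 ∷
  0b1011001010001000101 ∷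
  0b1110001100000010000 ∷
  0b0100110000100100001 ∷
  0b0101000000001010100 ∷
  0b0011101111010100010 ∷
  0b0101100011000000010 ∷
  0b0100011010100100010 ∷
  0b0010110000000011101 ∷
  0b0000001101101000010 ∷ []
crossRows =
  0b0101001100000101010 ∷
  0b1101000000000000010 ∷
  0b0011100000000000101 ∷
  0b1110100000000000111 ∷
  0b0011000101100000101 ∷
  0b0000010000010100001 ∷
  0b1000001100000101000 ∷
  0b1000101001100101000 ∷
  0b0000000011011000010 ∷
  0b0000100110111000010 ∷
  0b0000100101100000000 ∷
  0b0000010011001100011 ∷
  0b0000000011010011110 ∷
  0b1000011100010001001 ∷
  0b0000000000001011100 ∷
  0b1000001100001110100 ∷
  0b0011100000001011001 ∷
  0b1101000011011000000 ∷
  0b0011110000010100100 ∷ []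

-- Rows and column weight are stored in the vertex so that evaluating the
-- search does not look them up again for every edge; the index makes the
-- encoding of Fin 57 visibly injective.
record Vertex : Set where
  field
    index      : Fin 57
    layer      : ℕ
    same cross : ℕ
    weight     : ℕ
    .{{weight≢0}} : NonZero weight
open Vertex

vertex : Fin 57 → Vertex
vertex v = record
  { index    = v
  ; layer    = toℕ (proj₂ (remQuot {19} 3 v))
  ; same     = lookup sameRows triple
  ; cross    = lookup crossRows triple
  ; weight   = 2 ^ (18 ∸ toℕ triple)
  ; weight≢0 = m^n≢0 2 (18 ∸ toℕ triple)
  }
  where triple = proj₁ (remQuot {19} 3 v)

-- Division by a power of two followed by parity extracts the binary digit in the column of `v`.
red : Vertex → Vertex → Bool
red u v = (if layer u ≡ᵇ layer v then same u else cross u) / weight v % 2 ≡ᵇ 1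

coloring : Coloring 57
coloring = record
  { colour    = λ i j → red (vertex i) (vertex j)
  ; symmetric = from-yes (all? λ i → all? λ j → red (vertex i) (vertex j) Bool.≟ red (vertex j) (vertex i))
  }

vertices : List Vertex
vertices = map vertex (allFin 57)

open CliqueSearch red

no-monoClique : ∀ b k → cliqueFree b k vertices ≡ true → ¬ MonoClique coloring b k
no-monoClique b k free (f , inj , mono) =
  cliqueFree-sound b k vertices free (vertex ∘ f) (inj ∘ cong index) mono
    λ i → ∈-map⁺ vertex (∈-allFin (f i))

mainTheorem1 : RamseyLowerWitness 57 4 8
-- Each `refl` makes the type checker run the search.
mainTheorem1 = coloring , no-monoClique true 4 refl , no-monoClique false 8 refl
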